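{- Let $G$ be a connected finite simple graph. Then $sn(G)=|G|-1$ if, and only if, $G$ is a complete graph.
   Context: Graphs are finite and simple; $|G|$ denotes the number of vertices of $G$; a connected graph has at least one vertex. All colourings are vertex-colourings. $\chi(G)$ is the chromatic number of $G$, and a $\chi(G)$-colouring uses colours from the fixed set $[\chi(G)]=\{1,\dots,\chi(G)\}$. A partial proper $\chi(G)$-colouring of $G$ is an assignment of colours from $[\chi(G)]$ to the vertices of some subset of $V(G)$ such that no two adjacent coloured vertices have the same colour. A colouring $\phi$ extends a partial colouring $\psi$ if every vertex coloured in $\psi$ receives the same colour in $\phi$. A Sudoku colouring of $G$ is a partial proper $\chi(G)$-colouring of $G$ which has precisely one extension to a proper $\chi(G)$-colouring of all the vertices of $G$. The Sudoku number $sn(G)$ is the smallest number of coloured vertices in a Sudoku colouring of $G$. -}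

module Defs where

open import Data.Fin.Base using (Fin; zero; suc)
open import Data.Fin.Properties using (_≟_; any?; all?)
open import Data.Fin.Subset using (Subset; ∣_∣)
open import Data.Maybe.Base using (Maybe; just; nothing; is-just)
open import Data.Maybe.Properties using (just-injective; ≡-dec)
import Data.Nat.Properties as ℕ
open import Data.Nat.Base using (ℕ; zero; suc; _≤_; _<_; z≤n; s≤s)
open import Data.Product.Base using (_×_; _,_; ∃; ∃-syntax; proj₁; proj₂)
open import Data.Product using (∃!)
open import Data.Vec.Base using (tabulate)
open import Data.Vec.Functional using (_∷_; [])
open import Data.Vec.Properties using (tabulate-cong)
open import Function.Base using (_∘_; id)
open import Level using (0ℓ)
open import Relation.Binary.Construct.Closure.ReflexiveTransitive using (Star)
open import Relation.Binary.Core using (Rel)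
import Relation.Binary.Definitions as B
open import Relation.Binary.PropositionalEquality
  using (_≡_; _≢_; _≗_; refl; sym; trans; cong)
open import Relation.Nullary using (¬_; Dec; yes; no; contradiction)
open import Relation.Nullary.Decidable
  using (map′; ¬?; _×-dec_; _→-dec_; decidable-stable)
open import Relation.Unary using (Pred; Decidable)

record Graph : Set₁ where
  field
    order : ℕ
    Adj   : Rel (Fin order) 0ℓ
    adj?  : B.Decidable Adj
    adj-sym    : B.Symmetric Adj
    adj-irrefl : B.Irreflexive _≡_ Adj

  Vertex : Set
  Vertex = Fin order

open Graph using (order; Vertex)

Connected : Graph → Set
Connected G = 0 < order G × (∀ u v → Star (Graph.Adj G) u v)

Complete : Graph → Set
Complete G = ∀ u v → u ≢ v → Graph.Adj G u v

record Least (P : Pred ℕ 0ℓ) : Set where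
  field
    value   : ℕ
    holds   : P value
    minimal : ∀ m → P m → value ≤ m

least : {P : Pred ℕ 0ℓ} → Decidable P → ∀ n → P n → Least P
least P? zero p = record { value = 0 ; holds = p ; minimal = λ _ _ → z≤n }
least {P} P? (suc n) p with P? 0
... | yes p₀ = record { value = 0 ; holds = p₀ ; minimal = λ _ _ → z≤n }
... | no ¬p₀ = record
  { value   = suc L.value
  ; holds   = L.holds
  ; minimal = λ { zero p₀ → contradiction p₀ ¬p₀ ; (suc m) q → s≤s (L.minimal m q) }
  }
  where module L = Least (least {P ∘ suc} (P? ∘ suc) n p)

-- Exhaustive search over functions out of Fin n. Without function
-- extensionality, the predicate has to respect pointwise equality.

Respects≗ : {A B : Set} → Pred (A → B) 0ℓ → Set
Respects≗ P = ∀ {f g} → f ≗ g → P f → P g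

Searchable : Set → Set₁
Searchable A = {P : Pred A 0ℓ} → Decidable P → Dec (∃ P)

anyMaybe? : {A : Set} → Searchable A → Searchable (Maybe A)
anyMaybe? any {P} P? with P? nothing | any (P? ∘ just)
... | yes p | _           = yes (nothing , p)
... | no _  | yes (a , p) = yes (just a , p)
... | no ¬p | no ¬q       = no λ { (nothing , p) → ¬p p ; (just a , q) → ¬q (a , q) }

∷-cong : ∀ {A : Set} {n} (a : A) {f g : Fin n → A} → f ≗ g → (a ∷ f) ≗ (a ∷ g)
∷-cong a f≗g zero    = refl
∷-cong a f≗g (suc i) = f≗g i

∷-η : ∀ {A : Set} {n} (f : Fin (suc n) → A) → f ≗ (f zero ∷ (f ∘ suc))
∷-η f zero    = refl
∷-η f (suc i) = refl

anyFun? : ∀ {A : Set} n → Searchable A → {P : Pred (Fin n → A) 0ℓ} →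
          Respects≗ P → Decidable P → Dec (∃ P)
anyFun? zero any resp P? =
  map′ ([] ,_) (λ (f , p) → resp (λ ()) p) (P? [])
anyFun? (suc n) any {P} resp P? =
  map′ (λ (a , f , p) → (a ∷ f) , p)
       (λ (f , p) → f zero , f ∘ suc , resp (∷-η f) p)
       (any λ a → anyFun? n any (resp ∘ ∷-cong a) (P? ∘ (a ∷_)))

module _ (G : Graph) where
  open Graph G using (Adj; adj?; adj-irrefl)

  Colouring : ℕ → Set
  Colouring k = Vertex G → Fin k

  Proper : ∀ {k} → Colouring k → Set
  Proper φ = ∀ u v → Adj u v → φ u ≢ φ v

  Colourable : ℕ → Set
  Colourable k = ∃[ φ ] Proper {k} φ

  proper-resp : ∀ {k} → Respects≗ (Proper {k})
  proper-resp f≗g p u v uv e = p u v uv (trans (f≗g u) (trans e (sym (f≗g v))))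

  proper? : ∀ {k} → Decidable (Proper {k})
  proper? φ = all? λ u → all? λ v → adj? u v →-dec ¬? (φ u ≟ φ v)

  colourable? : Decidable Colourable
  colourable? k = anyFun? (order G) any? proper-resp proper?

  chromatic : Least Colourable
  chromatic = least colourable? (order G) (id , λ u v uv e → adj-irrefl e uv)

  χ : ℕ
  χ = Least.value chromatic

  -- An uncoloured vertex is sent to nothing.
  PartialColouring : Set
  PartialColouring = Vertex G → Maybe (Fin χ)

  PartialProper : PartialColouring → Set
  PartialProper ψ = ∀ u v → Adj u v → ∀ c → ¬ (ψ u ≡ just c × ψ v ≡ just c)

  Extends : Colouring χ → PartialColouring → Set
  Extends φ ψ = ∀ v c → ψ v ≡ just c → φ v ≡ c

  ProperExtension : PartialColouring → Colouring χ → Set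
  ProperExtension ψ φ = Proper φ × Extends φ ψ

  Sudoku : PartialColouring → Set
  Sudoku ψ = PartialProper ψ × ∃! _≗_ (ProperExtension ψ)

  coloured : PartialColouring → Subset (order G)
  coloured ψ = tabulate (is-just ∘ ψ)

  HasSudoku : ℕ → Set
  HasSudoku m = ∃[ ψ ] Sudoku ψ × ∣ coloured ψ ∣ ≡ m

  partialProper? : Decidable PartialProper
  partialProper? ψ = all? λ u → all? λ v → adj? u v →-dec
    all? λ c → ¬? (≡-dec _≟_ (ψ u) (just c) ×-dec ≡-dec _≟_ (ψ v) (just c))

  extension? : ∀ ψ → Decidable (ProperExtension ψ)
  extension? ψ φ = proper? φ ×-dec
    all? λ v → all? λ c → ≡-dec _≟_ (ψ v) (just c) →-dec (φ v ≟ c)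

  extension-resp : ∀ ψ → Respects≗ (ProperExtension ψ)
  extension-resp ψ f≗g (p , e) =
    proper-resp f≗g p , λ v c eq → trans (sym (f≗g v)) (e v c eq)

  extension-respˡ : ∀ {ψ ψ′} → ψ ≗ ψ′ → ∀ {φ} → ProperExtension ψ φ → ProperExtension ψ′ φ
  extension-respˡ ψ≗ψ′ (p , e) = p , λ v c eq → e v c (trans (ψ≗ψ′ v) eq)

  uniqueExtension? : ∀ ψ → Dec (∃! _≗_ (ProperExtension ψ))
  uniqueExtension? ψ = anyFun? (order G) any? resp λ φ → extension? ψ φ ×-dec unique? φ
    where
    Unique : Colouring χ → Set
    Unique φ = ∀ {φ′} → ProperExtension ψ φ′ → φ ≗ φ′

    ≗? : (φ φ′ : Colouring χ) → Dec (φ ≗ φ′)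
    ≗? φ φ′ = all? λ v → φ v ≟ φ′ v

    resp : Respects≗ λ φ → ProperExtension ψ φ × Unique φ
    resp f≗g (p , u) = extension-resp ψ f≗g p , λ q v → trans (sym (f≗g v)) (u q v)

    unique? : (φ : Colouring χ) → Dec (Unique φ)
    unique? φ = map′
      (λ none {φ′} q → decidable-stable (≗? φ φ′) λ ne → none (φ′ , q , ne))
      (λ u (φ′ , q , ne) → ne (u q))
      (¬? (anyFun? (order G) any?
        (λ f≗g (q , ne) → extension-resp ψ f≗g q ,
          λ e → ne λ v → trans (e v) (sym (f≗g v)))
        λ φ′ → extension? ψ φ′ ×-dec ¬? (≗? φ φ′)))

  sudoku? : Decidable Sudoku
  sudoku? ψ = partialProper? ψ ×-dec uniqueExtension? ψ

  sudoku-resp : Respects≗ Sudoku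
  sudoku-resp f≗g (p , φ , e , u) =
    (λ a b ab c (q , r) → p a b ab c (trans (f≗g a) q , trans (f≗g b) r)) ,
    φ , extension-respˡ f≗g e , λ e′ → u (extension-respˡ (sym ∘ f≗g) e′)

  hasSudoku? : Decidable HasSudoku
  hasSudoku? m = anyFun? (order G) (anyMaybe? any?)
    (λ f≗g (s , e) → sudoku-resp f≗g s ,
      trans (cong ∣_∣ (tabulate-cong (λ v → cong is-just (sym (f≗g v))))) e)
    λ ψ → sudoku? ψ ×-dec (∣ coloured ψ ∣ ℕ.≟ m)

  -- Colouring every vertex of a proper χ-colouring gives a Sudoku colouring.
  full-sudoku : ∀ {φ} → Proper φ → Sudoku (just ∘ φ)
  full-sudoku {φ} p =
    (λ u v uv c (q , r) → p u v uv (just-injective (trans q (sym r)))) ,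
    φ , (p , λ v c → just-injective) , λ (_ , e) v → sym (e v (φ v) refl)

  sudoku : Least HasSudoku
  sudoku = least hasSudoku? _
    (just ∘ proj₁ φ , full-sudoku (proj₂ φ) , refl)
    where φ = Least.holds chromatic

  sn : ℕ
  sn = Least.value sudoku

-- Call a vertex dominating in a proper colouring if it sees every colour but
-- its own. In a proper χ-colouring every colour class has a dominating vertex:
-- otherwise each of its vertices could move to a colour it does not see, and
-- one colour would be saved. A dominating vertex is forced by the colours of
-- the other vertices, so sn G ≤ |G| - 1.
--
-- If u and v are distinct and non-adjacent, two vertices can be left
-- uncoloured. If both are dominating, take u and v. Otherwise connectedness
-- gives a dominating x adjacent to a non-dominating w; take x and a dominating
-- y of the colour of w. Then x is forced even without y, since it sees the
-- colour of y at w, and afterwards y is forced.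
--
-- In a complete graph, two uncoloured vertices could exchange their colours.
module Submission where

open import Defs
open import Data.Bool.Base using (true)
open import Data.Fin.Base using (Fin; fromℕ<; punchOut)
open import Data.Fin.Permutation.Components using (transpose; transpose-inverse)
open import Data.Fin.Properties using (_≟_; any?; all?; punchOut-injective; ¬∀⟶∃¬)
open import Data.Fin.Subset using (Subset; ∣_∣; _∈_; _∉_; _⊆_; ⁅_⁆; _∪_; ∁; ⊤)
open import Data.Fin.Subset.Properties
  using (_∈?_; ∣p∣≤n; ∣⊤∣≡n; ∣⁅x⁆∣≡1; ∣∁p∣≡n∸∣p∣; p⊆q⇒∣p∣≤∣q∣; p⊂q⇒∣p∣<∣q∣;
         x∈⁅x⁆; x∈⁅y⁆⇒x≡y; x∉p⇒x∈∁p; x∈∁p⇒x∉p; x∈p∪q⁺; x∈p∪q⁻; p⊆p∪q)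
open import Data.Maybe.Base using (just; nothing; is-just)
open import Data.Maybe.Properties using (just-injective)
open import Data.Nat.Base using (suc; pred; _∸_; _≤_; _<_)
open import Data.Nat.Properties as ℕ using (≤-trans; ≤-reflexive; ≤-antisym; <-irrefl)
open import Data.Product.Base using (_×_; _,_; ∃-syntax; proj₁; proj₂)
open import Data.Sum.Base using (inj₂; [_,_]′)
open import Data.Vec.Properties using (lookup⇒[]=; []=⇒lookup; lookup∘tabulate)
open import Function.Base using (_∘_; case_of_)
open import Function.Bundles using (_⇔_; mk⇔)
open import Level using (0ℓ)
open import Relation.Binary.Construct.Closure.ReflexiveTransitive using (Star; ε; _◅_)
open import Relation.Binary.Core using (Rel)
open import Relation.Binary.PropositionalEquality
  using (_≡_; _≢_; refl; sym; trans; cong; subst; ≢-sym)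
open import Relation.Nullary using (¬_; yes; no; contradiction)
open import Relation.Nullary.Decidable
  using (¬?; _×-dec_; _→-dec_; decidable-stable; dec-true; dec-false)
open import Relation.Unary using (Pred; Decidable)

open Graph using (Vertex)

-- Walks, two-element sets and transpositions.

crossing : ∀ {A : Set} {R : Rel A 0ℓ} {P : Pred A 0ℓ} → Decidable P → ∀ {a b} →
           Star R a b → P a → ¬ P b → ∃[ x ] ∃[ y ] R x y × P x × ¬ P y
crossing P? ε pa ¬pb = contradiction pa ¬pb
crossing P? (_◅_ {j = c} ac cb) pa ¬pb with P? c
... | yes pc = crossing P? cb pc ¬pb
... | no ¬pc = _ , c , ac , pa , ¬pc

∈-pair⁻ : ∀ {n} {u v w : Fin n} {A : Set} → w ∈ ⁅ u ⁆ ∪ ⁅ v ⁆ → (w ≡ u → A) → (w ≡ v → A) → A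
∈-pair⁻ {u = u} {v} w∈ f g =
  [ f ∘ x∈⁅y⁆⇒x≡y u , g ∘ x∈⁅y⁆⇒x≡y v ]′ (x∈p∪q⁻ ⁅ u ⁆ ⁅ v ⁆ w∈)

∉-pair : ∀ {n} {u v w : Fin n} → w ≢ u → w ≢ v → w ∉ ⁅ u ⁆ ∪ ⁅ v ⁆
∉-pair w≢u w≢v w∈ = ∈-pair⁻ w∈ w≢u w≢v

1<∣pair∣ : ∀ {n} {u v : Fin n} → u ≢ v → 1 < ∣ ⁅ u ⁆ ∪ ⁅ v ⁆ ∣
1<∣pair∣ {u = u} {v} u≢v = subst (_< ∣ ⁅ u ⁆ ∪ ⁅ v ⁆ ∣) (∣⁅x⁆∣≡1 u)
  (p⊂q⇒∣p∣<∣q∣ (p⊆p∪q ⁅ v ⁆ , v , x∈p∪q⁺ (inj₂ (x∈⁅x⁆ v)) , λ v∈ → u≢v (sym (x∈⁅y⁆⇒x≡y u v∈))))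

transpose-injective : ∀ {n} (i j : Fin n) {x y} → transpose i j x ≡ transpose i j y → x ≡ y
transpose-injective i j eq =
  trans (sym (transpose-inverse j i)) (trans (cong (transpose j i) eq) (transpose-inverse j i))

transpose-matchˡ : ∀ {n} (i j : Fin n) → transpose i j i ≡ j
transpose-matchˡ i j rewrite dec-true (i ≟ i) refl = refl

transpose-mismatch : ∀ {n} (i j : Fin n) {k} → k ≢ i → k ≢ j → transpose i j k ≡ k
transpose-mismatch i j {k} k≢i k≢j
  rewrite dec-false (k ≟ i) k≢i | dec-false (k ≟ j) k≢j = refl

module _ (G : Graph) where
  open Graph G using (order; Adj; adj?; adj-sym; adj-irrefl)

  -- Dominating vertices in proper colourings.

  adj⇒≢ : ∀ {u v} → Adj u v → u ≢ v
  adj⇒≢ uv u≡v = adj-irrefl u≡v uv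

  Dominating : ∀ {k} → Colouring G k → Pred (Vertex G) 0ℓ
  Dominating φ v = ∀ c → c ≢ φ v → ∃[ w ] Adj v w × φ w ≡ c

  dominating? : ∀ {k} (φ : Colouring G k) → Decidable (Dominating φ)
  dominating? φ v = all? λ c → ¬? (c ≟ φ v) →-dec any? λ w → adj? v w ×-dec (φ w ≟ c)

  missing-colour : ∀ {k} (φ : Colouring G k) {v} → ¬ Dominating φ v →
                   ∃[ c ] c ≢ φ v × (∀ w → Adj v w → φ w ≢ c)
  missing-colour φ {v} ¬dom
    with c , ¬seen ← ¬∀⟶∃¬ _ _
      (λ c → ¬? (c ≟ φ v) →-dec any? λ w → adj? v w ×-dec (φ w ≟ c)) ¬dom
    -- The negated implication yields both facts: it would hold vacuously if `c ≡ φ v`, and by a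
    -- witness if some neighbour had colour `c`.
    = c , (λ eq → ¬seen (contradiction eq)) , λ w vw eq → ¬seen λ _ → w , vw , eq

  drop-colour : ∀ {k} (c : Fin k) {φ : Colouring G k} → Proper G φ → (∀ v → c ≢ φ v) →
                Colourable G (pred k)
  drop-colour {suc _} c prop avoids =
    (λ v → punchOut (avoids v)) ,
    λ u v uv eq → prop u v uv (punchOut-injective (avoids u) (avoids v) eq)

  module _ {k} {φ : Colouring G k} (prop : Proper G φ) (c : Fin k)
           (none : ∀ v → φ v ≡ c → ¬ Dominating φ v) where

    recolour : Colouring G k
    recolour v with φ v ≟ c
    ... | yes eq = proj₁ (missing-colour φ (none v eq))
    ... | no _   = φ v

    recolour-avoids : ∀ v → c ≢ recolour v
    recolour-avoids v with φ v ≟ c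
    ... | yes eq = λ e → proj₁ (proj₂ (missing-colour φ (none v eq))) (trans (sym e) (sym eq))
    ... | no neq = ≢-sym neq

    -- Adjacent vertices cannot both have colour `c` in `φ`, so at most one end of an edge moves,
    -- and it moves to a colour that no neighbour has in `φ`.
    recolour-proper : Proper G recolour
    recolour-proper u v uv with φ u ≟ c | φ v ≟ c
    ... | yes eu | yes ev = λ _ → prop u v uv (trans eu (sym ev))
    ... | yes eu | no _   = λ e → proj₂ (proj₂ (missing-colour φ (none u eu))) v uv (sym e)
    ... | no _   | yes ev = proj₂ (proj₂ (missing-colour φ (none v ev))) u (adj-sym uv)
    ... | no _   | no _   = prop u v uv

  -- Since `pred 0` is `0`, a colour is required to rule out `χ G ≡ 0`.
  χ≰pred : Fin (χ G) → ¬ (χ G ≤ pred (χ G))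
  χ≰pred with χ G
  ... | suc _ = λ _ → <-irrefl refl

  dominating-of : {φ : Colouring G (χ G)} → Proper G φ → ∀ c → ∃[ v ] φ v ≡ c × Dominating φ v
  dominating-of {φ} prop c =
    decidable-stable (any? λ v → (φ v ≟ c) ×-dec dominating? φ v) λ none →
      let ¬dom = λ v eq dom → none (v , eq , dom) in
      χ≰pred c (Least.minimal (chromatic G) _
        (drop-colour c (recolour-proper prop c ¬dom) (recolour-avoids prop c ¬dom)))

  -- Forced colours and uncoloured sets.

  forced : ∀ {k} (φ : Colouring G k) {φ′ : Colouring G k} → Proper G φ′ → ∀ v →
           (∀ c → c ≢ φ v → ∃[ w ] Adj v w × φ w ≡ c × φ′ w ≡ φ w) → φ′ v ≡ φ v
  forced φ {φ′} prop′ v sees = decidable-stable (φ′ v ≟ φ v) λ neq →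
    -- A different colour `φ′ v` would already appear on a neighbour where `φ′` agrees with `φ`.
    let w , vw , φw , φ′w = sees (φ′ v) neq
    in prop′ v w vw (sym (trans φ′w φw))

  -- `S` may be left uncoloured in `φ`; phrasing this with total colourings keeps `Maybe` out of the
  -- forcing arguments.
  Determined : ∀ {k} → Subset order → Colouring G k → Set
  Determined S φ = ∀ {φ′} → Proper G φ′ → (∀ w → w ∉ S → φ′ w ≡ φ w) →
                   ∀ w → w ∈ S → φ′ w ≡ φ w

  uncolour : Subset order → Colouring G (χ G) → PartialColouring G
  uncolour S φ w with w ∈? S
  ... | yes _ = nothing
  ... | no _  = just (φ w)

  uncolour-just : ∀ S φ {w c} → uncolour S φ w ≡ just c → φ w ≡ c
  uncolour-just S φ {w} eq with w ∈? S
  ... | no _ = just-injective eq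

  uncolour-∉ : ∀ S φ {w} → w ∉ S → uncolour S φ w ≡ just (φ w)
  uncolour-∉ S φ {w} w∉S with w ∈? S
  ... | yes w∈S = contradiction w∈S w∉S
  ... | no _    = refl

  uncolour-sudoku : ∀ {S φ} → Proper G φ → Determined S φ → Sudoku G (uncolour S φ)
  uncolour-sudoku {S} {φ} prop det =
    (λ u v uv c (eu , ev) → prop u v uv
      (trans (uncolour-just S φ eu) (sym (uncolour-just S φ ev)))) ,
    φ , (prop , λ v c → uncolour-just S φ) , unique
    where
    unique : ∀ {φ′} → ProperExtension G (uncolour S φ) φ′ → ∀ w → φ w ≡ φ′ w
    unique {φ′} (prop′ , ext) w = sym (case w ∈? S of λ
      { (yes w∈S) → det prop′ outside w w∈S
      ; (no w∉S)  → outside w w∉S })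
      where
      outside : ∀ w → w ∉ S → φ′ w ≡ φ w
      outside w w∉S = ext w (φ w) (uncolour-∉ S φ w∉S)

  ∈-coloured⁻ : ∀ ψ {w} → w ∈ coloured G ψ → is-just (ψ w) ≡ true
  ∈-coloured⁻ ψ {w} w∈ = trans (sym (lookup∘tabulate (is-just ∘ ψ) w)) ([]=⇒lookup w∈)

  ∉-coloured⁻ : ∀ ψ {w} → w ∉ coloured G ψ → ψ w ≡ nothing
  ∉-coloured⁻ ψ {w} w∉ with ψ w in eq
  ... | nothing = refl
  ... | just _  = contradiction
    (lookup⇒[]= w _ (trans (lookup∘tabulate (is-just ∘ ψ) w) (cong is-just eq))) w∉

  -- Inclusion suffices, as only an upper bound on `sn G` is drawn from it.
  coloured-uncolour : ∀ S φ → coloured G (uncolour S φ) ⊆ ∁ S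
  coloured-uncolour S φ {w} w∈ = x∉p⇒x∈∁p λ w∈S →
    case trans (sym (∈-coloured⁻ (uncolour S φ) w∈)) (cong is-just (uncolour-∈ w∈S)) of λ ()
    where
    uncolour-∈ : w ∈ S → uncolour S φ w ≡ nothing
    uncolour-∈ w∈S with w ∈? S
    ... | yes _   = refl
    ... | no w∉S = contradiction w∈S w∉S

  sn≤ : ∀ S {φ : Colouring G (χ G)} → Proper G φ → Determined S φ → sn G ≤ order ∸ ∣ S ∣
  sn≤ S {φ} prop det = ≤-trans
    (Least.minimal (sudoku G) _ (uncolour S φ , uncolour-sudoku prop det , refl))
    (≤-trans (p⊆q⇒∣p∣≤∣q∣ (coloured-uncolour S φ)) (≤-reflexive (∣∁p∣≡n∸∣p∣ S)))

  -- Determined sets of one and two vertices.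

  dominating-determined : ∀ {k} (φ : Colouring G k) {v} → Dominating φ v → Determined ⁅ v ⁆ φ
  dominating-determined φ {v} dom prop′ agree w w∈ with refl ← x∈⁅y⁆⇒x≡y v w∈ =
    forced φ prop′ v λ c c≢ →
      let x , vx , φx = dom c c≢
      in x , vx , φx , agree x (λ x∈ → adj⇒≢ vx (sym (x∈⁅y⁆⇒x≡y v x∈)))

  sn≤order∸1 : Vertex G → {φ : Colouring G (χ G)} → Proper G φ → sn G ≤ order ∸ 1
  sn≤order∸1 u {φ} prop =
    -- `u` supplies a colour whose class can be searched.
    let v , _ , dom = dominating-of prop (φ u)
    in ≤-trans (sn≤ ⁅ v ⁆ prop (dominating-determined φ dom))
               (≤-reflexive (cong (order ∸_) (∣⁅x⁆∣≡1 v)))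

  -- Every neighbour of `u` or `v` lies outside the pair, so all domination witnesses keep their
  -- colours and neither vertex waits for the other.
  non-adjacent-determined : ∀ {k} {φ : Colouring G k} {u v} → ¬ Adj u v →
    Dominating φ u → Dominating φ v → Determined (⁅ u ⁆ ∪ ⁅ v ⁆) φ
  non-adjacent-determined {φ = φ} {u} {v} ¬uv domᵤ domᵥ {φ′} prop′ agree w w∈ =
    ∈-pair⁻ w∈ (λ { refl → forced φ prop′ u seesᵤ }) (λ { refl → forced φ prop′ v seesᵥ })
    where
    seesᵤ : ∀ c → c ≢ φ u → ∃[ x ] Adj u x × φ x ≡ c × φ′ x ≡ φ x
    seesᵤ c c≢ =
      let x , ux , φx = domᵤ c c≢
      in x , ux , φx , agree x (∉-pair (≢-sym (adj⇒≢ ux)) λ { refl → ¬uv ux })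

    seesᵥ : ∀ c → c ≢ φ v → ∃[ x ] Adj v x × φ x ≡ c × φ′ x ≡ φ x
    seesᵥ c c≢ =
      let x , vx , φx = domᵥ c c≢
      in x , vx , φx , agree x (∉-pair (λ { refl → ¬uv (adj-sym vx) }) (≢-sym (adj⇒≢ vx)))

  -- `x` and `y` may be adjacent, so they are forced in turn: first `x`, with `w` showing it the
  -- colour of `y`.
  repeated-neighbour-determined : ∀ {k} {φ : Colouring G k} {x y w} → Proper G φ →
    Adj x w → w ≢ y → φ w ≡ φ y → Dominating φ x → Dominating φ y →
    Determined (⁅ x ⁆ ∪ ⁅ y ⁆) φ
  repeated-neighbour-determined
    {φ = φ} {x} {y} {w} prop xw w≢y φw≡φy domₓ domᵧ {φ′} prop′ agree z z∈ =
    ∈-pair⁻ z∈ (λ { refl → φ′x }) (λ { refl → forced φ prop′ y seesᵧ })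
    where
    seesₓ : ∀ c → c ≢ φ x → ∃[ z ] Adj x z × φ z ≡ c × φ′ z ≡ φ z
    seesₓ c c≢ with c ≟ φ y
    ... | yes refl = w , xw , φw≡φy , agree w (∉-pair (≢-sym (adj⇒≢ xw)) w≢y)
    ... | no c≢φy =
      let z , xz , φz = domₓ c c≢
      -- Having a colour other than `φ y`, `z` is not `y`.
      in z , xz , φz , agree z (∉-pair (≢-sym (adj⇒≢ xz)) λ { refl → c≢φy (sym φz) })

    φ′x : φ′ x ≡ φ x
    φ′x = forced φ prop′ x seesₓ

    seesᵧ : ∀ c → c ≢ φ y → ∃[ z ] Adj y z × φ z ≡ c × φ′ z ≡ φ z
    seesᵧ c c≢ with domᵧ c c≢
    ... | z , yz , φz with z ≟ x
    -- The witness may be `x`, whose colour has been recovered by now.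
    ...   | yes refl = z , yz , φz , φ′x
    ...   | no z≢x   = z , yz , φz , agree z (∉-pair z≢x (≢-sym (adj⇒≢ yz)))

  DeterminedPair : ∀ {k} → Colouring G k → Set
  DeterminedPair φ = ∃[ u ] ∃[ v ] u ≢ v × Determined (⁅ u ⁆ ∪ ⁅ v ⁆) φ

  non-dominating⇒pair : Connected G → {φ : Colouring G (χ G)} → Proper G φ →
                        ∀ {v} → ¬ Dominating φ v → DeterminedPair φ
  non-dominating⇒pair (_ , path) {φ} prop {v} ¬dom =
    -- Any dominating vertex can start the walk to `v`; `φ v` is a colour at hand.
    let a , _ , domₐ = dominating-of prop (φ v)
        x , w , xw , domₓ , ¬domw = crossing (dominating? φ) (path a v) domₐ ¬dom
        y , φy≡φw , domᵧ = dominating-of prop (φ w)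
        -- `y` is dominating and `w` is not.
        w≢y = λ w≡y → ¬domw (subst (Dominating φ) (sym w≡y) domᵧ)
    -- The neighbours `x` and `w` differ in colour, while `w` and `y` share theirs.
    in x , y , (λ x≡y → prop x w xw (trans (cong φ x≡y) φy≡φw)) ,
       repeated-neighbour-determined prop xw w≢y (sym φy≡φw) domₓ domᵧ

  non-adjacent⇒pair : Connected G → {φ : Colouring G (χ G)} → Proper G φ →
                      ∀ {u v} → u ≢ v → ¬ Adj u v → DeterminedPair φ
  non-adjacent⇒pair conn {φ} prop {u} {v} u≢v ¬uv with dominating? φ u | dominating? φ v
  ... | no ¬domᵤ | _        = non-dominating⇒pair conn prop ¬domᵤ
  ... | yes _    | no ¬domᵥ = non-dominating⇒pair conn prop ¬domᵥ
  ... | yes domᵤ | yes domᵥ = u , v , u≢v , non-adjacent-determined ¬uv domᵤ domᵥ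

  pair⇒sn<order∸1 : {φ : Colouring G (χ G)} → Proper G φ → DeterminedPair φ → sn G < order ∸ 1
  pair⇒sn<order∸1 prop (u , v , u≢v , det) = ℕ.≤-<-trans
    (sn≤ (⁅ u ⁆ ∪ ⁅ v ⁆) prop det)
    -- Truncated subtraction is strict here because the pair has at most `order` elements.
    (ℕ.∸-monoʳ-< (1<∣pair∣ u≢v) (∣p∣≤n (⁅ u ⁆ ∪ ⁅ v ⁆)))

  -- Complete graphs.

  uncoloured-unique : Complete G → ∀ {ψ} → Sudoku G ψ →
                      ∀ {u v} → ψ u ≡ nothing → ψ v ≡ nothing → u ≡ v
  uncoloured-unique compl {ψ} (_ , φ , (prop , ext) , unique) {u} {v} ψu ψv =
    decidable-stable (u ≟ v) λ u≢v →
      -- Uniqueness equates `φ` with its swapped version, so adjacent `u` and `v` would share a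
      -- colour.
      prop u v (compl u v u≢v)
        (trans (unique {φ ∘ transpose u v} (prop′ , ext′) u) (cong φ (transpose-matchˡ u v)))
    where
    prop′ : Proper G (φ ∘ transpose u v)
    -- Distinct vertices stay distinct under the transposition, hence adjacent by completeness.
    prop′ a b ab = prop _ _ (compl _ _ (adj⇒≢ ab ∘ transpose-injective u v))

    nothing≢just : ∀ {w x c} → ψ x ≡ nothing → ψ w ≡ just c → w ≢ x
    nothing≢just ψx ψw refl = case trans (sym ψx) ψw of λ ()

    ext′ : Extends G (φ ∘ transpose u v) ψ
    ext′ w c ψw = trans
      (cong φ (transpose-mismatch u v (nothing≢just ψu ψw) (nothing≢just ψv ψw)))
      (ext w c ψw)

  -- Either some `u` is uncoloured and all other vertices are coloured, or every vertex is coloured.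
  order∸1≤coloured : ∀ ψ → (∀ {u v} → ψ u ≡ nothing → ψ v ≡ nothing → u ≡ v) →
                     order ∸ 1 ≤ ∣ coloured G ψ ∣
  order∸1≤coloured ψ unique with any? (λ u → ¬? (u ∈? coloured G ψ))
  ... | yes (u , u∉) = subst (λ m → order ∸ m ≤ ∣ coloured G ψ ∣) (∣⁅x⁆∣≡1 u)
    (subst (_≤ ∣ coloured G ψ ∣) (∣∁p∣≡n∸∣p∣ ⁅ u ⁆) (p⊆q⇒∣p∣≤∣q∣ ∁u⊆))
    where
    ∁u⊆ : ∁ ⁅ u ⁆ ⊆ coloured G ψ
    ∁u⊆ {w} w∈ = decidable-stable (w ∈? coloured G ψ) λ w∉ →
      x∈∁p⇒x∉p w∈ (subst (_∈ ⁅ u ⁆) (unique (∉-coloured⁻ ψ u∉) (∉-coloured⁻ ψ w∉)) (x∈⁅x⁆ u))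
  ... | no none = ≤-trans (ℕ.m∸n≤m order 1)
    (subst (_≤ ∣ coloured G ψ ∣) (∣⊤∣≡n order)
      (p⊆q⇒∣p∣≤∣q∣ {p = ⊤} λ {w} _ → decidable-stable (w ∈? coloured G ψ) λ w∉ → none (w , w∉)))

  complete⇒order∸1≤sn : Complete G → order ∸ 1 ≤ sn G
  complete⇒order∸1≤sn compl =
    let ψ , sud , eq = Least.holds (sudoku G)
    in subst (order ∸ 1 ≤_) eq (order∸1≤coloured ψ (uncoloured-unique compl sud))

theorem2 : (G : Graph) → Connected G → (sn G ≡ Graph.order G ∸ 1) ⇔ Complete G
theorem2 G conn = mk⇔
  (λ eq u v u≢v → decidable-stable (Graph.adj? G u v) λ ¬uv →
    <-irrefl eq (pair⇒sn<order∸1 G prop (non-adjacent⇒pair G conn prop u≢v ¬uv)))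
  -- The vertex comes from the positive order in `Connected`.
  (λ compl → ≤-antisym (sn≤order∸1 G (fromℕ< (proj₁ conn)) prop) (complete⇒order∸1≤sn G compl))
  where
  prop = proj₂ (Least.holds (chromatic G))
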